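{- Let $V=\mathbb{R}^{d_1}$ and $W=\mathbb{R}^{d_2}$ be real vector spaces of respective dimensions $d_1$ and $d_2$. Let $\Omega_1 = V \cap \mathbb{Z}^{d_1}=\mathbb{Z}^{d_1}$ and $\Omega_2 = W \cap \mathbb{Z}^{d_2}=\mathbb{Z}^{d_2}$. Let $\rho: V \to W$ be a linear map such that $\rho(\Omega_1) \subseteq \Omega_2$. Let $U = \ker(\rho)$, and let $\Omega = U \cap \Omega_1$. Let $J$ be the rank of $\Omega$. Then for any subspace $U_0$ of $U$ which does not contain $\Omega$ there exists a point $\boldsymbol{x} \in \Omega \setminus U_0$ such that $$H(\boldsymbol{x}) \leq \left\{ 2 J^J \left( \frac{3}{2} \right)^{J-1} + J \right\} H(\Omega).$$
   Context: For $\boldsymbol{x}=(x_1,\dots,x_N)\in\mathbb{Z}^N$, the height is $H(\boldsymbol{x})=\max_{1\leq i\leq N}|x_i|$. For a lattice (subgroup) $\Lambda\subseteq\mathbb{Z}^N$ of rank $J\geq 1$, choose a $\mathbb{Z}$-basis $\boldsymbol{x}_1,\dots,\boldsymbol{x}_J$ and let $X=(\boldsymbol{x}_1\ \dots\ \boldsymbol{x}_J)$ be the $N\times J$ basis matrix. For each subset $I\subseteq\{1,\dots,N\}$ of cardinality $J$ let $X_I$ be the $J\times J$ submatrix formed by the rows of $X$ indexed by $I$. The height of the lattice is $H(\Lambda)=\max_{I}|\det(X_I)|$, which does not depend on the choice of basis. Here these are applied with $N=d_1$. (If some $U_0$ does not contain $\Omega$ then $\Omega\neq 0$, so $J\geq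 1$.) -}

module Defs where

open import Algebra.Bundles using (CommutativeRing)
open import Algebra.Module.Bundles using (Module)
open import Algebra.Module.Structures.Biased using (IsModuleFromLeft)
import Algebra.Construct.Pointwise as Pointwise
import Algebra.Definitions.RawMonoid as RawMonoidDefinitions
import Algebra.Definitions.RawSemiring as RawSemiringDefinitions
import Algebra.Module.Morphism.Structures as ModuleMorphisms
open import Data.Fin.Base using (Fin; zero; suc; toℕ)
open import Data.Integer.Base as ℤ using (ℤ; +_; 0ℤ; 1ℤ; -1ℤ)
open import Data.List.Base as List using (List; []; _∷_; [_]; _++_)
open import Data.List.Extrema.Nat using (max)
open import Data.Nat.Base as ℕ using (ℕ; zero; suc)
import Data.Nat.Properties as ℕ
open import Data.Product.Base using (∃; _,_; proj₁; proj₂)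
open import Data.Rational.Base as ℚ
  using (ℚ; 0ℚ; 1ℚ; ½; _<_; ∣_∣; 1/_; Positive; positive)
  renaming (_+_ to _+q_; _*_ to _*q_; -_ to -q_; _-_ to _-q_; _≤_ to _≤q_)
open import Data.Rational.Literals using (fromℤ)
import Data.Rational.Properties as ℚ
open import Data.Rational.Solver using (module +-*-Solver)
open import Data.Vec.Functional as Vector using (Vector; removeAt)
open import Function.Base using (_∘_)
open import Level using (0ℓ)
open import Relation.Binary.PropositionalEquality
  using (_≡_; _≗_; refl; sym; trans; cong; cong₂; subst)
open import Relation.Unary using (Pred; _∈_)

-- ℝ as Cauchy sequences of rationals; _≈_ is the equality of reals, namely
-- that the difference tends to zero.  Without eta, sums and products are
-- compared without unfolding their Cauchy proofs.

record ℝ : Set where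
  no-eta-equality
  field
    seq    : ℕ → ℚ
    cauchy : ∀ ε → 0ℚ < ε →
             ∃ λ N → ∀ m n → N ℕ.≤ m → N ℕ.≤ n → ∣ seq m -q seq n ∣ < ε

open ℝ public

infix 4 _≈_

record _≈_ (x y : ℝ) : Set where
  constructor mk≈
  field
    converge : ∀ ε → 0ℚ < ε →
               ∃ λ N → ∀ n → N ℕ.≤ n → ∣ seq x n -q seq y n ∣ < ε

open _≈_ public

private
  half-pos : ∀ {ε} → 0ℚ < ε → 0ℚ < ½ *q ε
  half-pos {ε} 0<ε =
    subst (_< ½ *q ε) (ℚ.*-zeroʳ ½) (ℚ.*-monoʳ-<-pos ½ 0<ε)

  half+half : ∀ ε → ½ *q ε +q ½ *q ε ≡ ε
  half+half = solve 1 (λ e → con ½ :* e :+ con ½ :* e := e) refl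
    where open +-*-Solver

  dist-sym : ∀ a b → ∣ a -q b ∣ ≡ ∣ b -q a ∣
  dist-sym a b = trans (sym (ℚ.∣-p∣≡∣p∣ (a -q b)))
    (cong ∣_∣ (solve 2 (λ a b → :- (a :- b) := b :- a) refl a b))
    where open +-*-Solver

  dist-refl : ∀ {ε} a → 0ℚ < ε → ∣ a -q a ∣ < ε
  dist-refl {ε} a = subst (_< ε) (sym (cong ∣_∣ (ℚ.+-inverseʳ a)))

  dist-trans : ∀ {ε} a b c → ∣ a -q b ∣ < ½ *q ε → ∣ b -q c ∣ < ½ *q ε → ∣ a -q c ∣ < ε
  dist-trans {ε} a b c p q = begin-strict
    ∣ a -q c ∣                 ≡⟨ cong ∣_∣ (solve 3 (λ a b c → a :- c := (a :- b) :+ (b :- c)) refl a b c) ⟩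
    ∣ (a -q b) +q (b -q c) ∣   ≤⟨ ℚ.∣p+q∣≤∣p∣+∣q∣ (a -q b) (b -q c) ⟩
    ∣ a -q b ∣ +q ∣ b -q c ∣   <⟨ ℚ.+-mono-< p q ⟩
    ½ *q ε +q ½ *q ε           ≡⟨ half+half ε ⟩
    ε                          ∎
    where open ℚ.≤-Reasoning
          open +-*-Solver

  dist-+ : ∀ {ε} a b c d → ∣ a -q c ∣ < ½ *q ε → ∣ b -q d ∣ < ½ *q ε →
           ∣ (a +q b) -q (c +q d) ∣ < ε
  dist-+ {ε} a b c d p q = begin-strict
    ∣ (a +q b) -q (c +q d) ∣   ≡⟨ cong ∣_∣ (solve 4 (λ a b c d → (a :+ b) :- (c :+ d) := (a :- c) :+ (b :- d)) refl a b c d) ⟩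
    ∣ (a -q c) +q (b -q d) ∣   ≤⟨ ℚ.∣p+q∣≤∣p∣+∣q∣ (a -q c) (b -q d) ⟩
    ∣ a -q c ∣ +q ∣ b -q d ∣   <⟨ ℚ.+-mono-< p q ⟩
    ½ *q ε +q ½ *q ε           ≡⟨ half+half ε ⟩
    ε                          ∎
    where open ℚ.≤-Reasoning
          open +-*-Solver

  dist-neg : ∀ a b → ∣ -q a -q -q b ∣ ≡ ∣ a -q b ∣
  dist-neg a b = trans
    (cong ∣_∣ (solve 2 (λ a b → :- a :- :- b := :- (a :- b)) refl a b))
    (ℚ.∣-p∣≡∣p∣ (a -q b))
    where open +-*-Solver

  mul-bound : ∀ {B δ} a b → 0ℚ < B → ∣ a ∣ ≤q B → ∣ b ∣ < δ → ∣ a *q b ∣ < B *q δ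
  mul-bound {B} {δ} a b 0<B p q = begin-strict
    ∣ a *q b ∣       ≡⟨ ℚ.∣p*q∣≡∣p∣*∣q∣ a b ⟩
    ∣ a ∣ *q ∣ b ∣   ≤⟨ ℚ.*-monoʳ-≤-nonNeg ∣ b ∣ {{ℚ.∣-∣-nonNeg b}} p ⟩
    B *q ∣ b ∣       <⟨ ℚ.*-monoʳ-<-pos B {{positive 0<B}} q ⟩
    B *q δ           ∎
    where open ℚ.≤-Reasoning

  scaled : ∀ B → 0ℚ < B → ∀ {ε} → 0ℚ < ε →
           ∃ λ δ → ∃ λ (_ : 0ℚ < δ) → B *q δ ≡ ½ *q ε
  scaled B 0<B {ε} 0<ε = inv *q (½ *q ε) , δ-pos , eq
    where
    instance
      B-pos : Positive B
      B-pos = positive 0<B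
      B≢0 : ℚ.NonZero B
      B≢0 = ℚ.pos⇒nonZero B
    inv : ℚ
    inv = 1/ B
    instance
      inv-pos : Positive inv
      inv-pos = ℚ.1/pos⇒pos B
    δ-pos : 0ℚ < inv *q (½ *q ε)
    δ-pos = subst (_< inv *q (½ *q ε)) (ℚ.*-zeroʳ inv) (ℚ.*-monoʳ-<-pos inv (half-pos 0<ε))
    eq : B *q (inv *q (½ *q ε)) ≡ ½ *q ε
    eq = trans (sym (ℚ.*-assoc B inv (½ *q ε)))
        (trans (cong (_*q (½ *q ε)) (ℚ.*-inverseʳ B)) (ℚ.*-identityˡ (½ *q ε)))

  dist-* : ∀ {ε A B δ δ′} a b c d → 0ℚ < A → 0ℚ < B → A *q δ ≡ ½ *q ε → B *q δ′ ≡ ½ *q ε →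
           ∣ a ∣ ≤q A → ∣ d ∣ ≤q B → ∣ b -q d ∣ < δ → ∣ a -q c ∣ < δ′ →
           ∣ (a *q b) -q (c *q d) ∣ < ε
  dist-* {ε} {A} {B} {δ} {δ′} a b c d 0<A 0<B eA eB pA pB p q = begin-strict
    ∣ (a *q b) -q (c *q d) ∣                   ≡⟨ cong ∣_∣ (solve 4 (λ a b c d → (a :* b) :- (c :* d) := a :* (b :- d) :+ d :* (a :- c)) refl a b c d) ⟩
    ∣ a *q (b -q d) +q d *q (a -q c) ∣         ≤⟨ ℚ.∣p+q∣≤∣p∣+∣q∣ (a *q (b -q d)) (d *q (a -q c)) ⟩
    ∣ a *q (b -q d) ∣ +q ∣ d *q (a -q c) ∣     <⟨ ℚ.+-mono-< (mul-bound a (b -q d) 0<A pA p) (mul-bound d (a -q c) 0<B pB q) ⟩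
    A *q δ +q B *q δ′                          ≡⟨ cong₂ _+q_ eA eB ⟩
    ½ *q ε +q ½ *q ε                           ≡⟨ half+half ε ⟩
    ε                                          ∎
    where open ℚ.≤-Reasoning
          open +-*-Solver

  eventually-bounded : ∀ x → ∃ λ B → ∃ λ (_ : 0ℚ < B) → ∃ λ N → ∀ n → N ℕ.≤ n → ∣ seq x n ∣ ≤q B
  eventually-bounded x = ∣ a ∣ +q 1ℚ , B-pos , N , bound
    where
    N = proj₁ (cauchy x 1ℚ (ℚ.positive⁻¹ 1ℚ))
    a = seq x N
    B-pos : 0ℚ < ∣ a ∣ +q 1ℚ
    B-pos = ℚ.+-mono-≤-< (ℚ.0≤∣p∣ a) (ℚ.positive⁻¹ 1ℚ)
    bound : ∀ n → N ℕ.≤ n → ∣ seq x n ∣ ≤q ∣ a ∣ +q 1ℚ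
    bound n N≤n = begin
      ∣ b ∣                  ≡⟨ cong ∣_∣ (solve 2 (λ a b → b := a :+ (b :- a)) refl a b) ⟩
      ∣ a +q (b -q a) ∣      ≤⟨ ℚ.∣p+q∣≤∣p∣+∣q∣ a (b -q a) ⟩
      ∣ a ∣ +q ∣ b -q a ∣    ≤⟨ ℚ.+-monoʳ-≤ ∣ a ∣ (ℚ.<⇒≤ (proj₂ (cauchy x 1ℚ (ℚ.positive⁻¹ 1ℚ)) n N N≤n ℕ.≤-refl)) ⟩
      ∣ a ∣ +q 1ℚ            ∎
      where
      b = seq x n
      open ℚ.≤-Reasoning
      open +-*-Solver

  left : ∀ {m n k} → m ℕ.⊔ n ℕ.≤ k → m ℕ.≤ k
  left {m} {n} = ℕ.m⊔n≤o⇒m≤o m n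

  right : ∀ {m n k} → m ℕ.⊔ n ℕ.≤ k → n ℕ.≤ k
  right {m} {n} = ℕ.m⊔n≤o⇒n≤o m n

  pointwise : ∀ {x y} → seq x ≗ seq y → x ≈ y
  pointwise {x} {y} eq = mk≈ λ ε 0<ε → 0 , λ n _ →
    subst (λ q → ∣ seq x n -q q ∣ < ε) (eq n) (dist-refl (seq x n) 0<ε)

  ≈-sym : ∀ {x y} → x ≈ y → y ≈ x
  ≈-sym {x} {y} (mk≈ p) = mk≈ λ ε 0<ε → proj₁ (p ε 0<ε) , λ n N≤n →
    subst (_< ε) (dist-sym (seq x n) (seq y n)) (proj₂ (p ε 0<ε) n N≤n)

  ≈-trans : ∀ {x y z} → x ≈ y → y ≈ z → x ≈ z
  ≈-trans {x} {y} {z} (mk≈ p) (mk≈ q) = mk≈ λ ε 0<ε →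
    let M , f = p (½ *q ε) (half-pos 0<ε)
        N , g = q (½ *q ε) (half-pos 0<ε)
    in M ℕ.⊔ N , λ n h →
       dist-trans (seq x n) (seq y n) (seq z n) (f n (left h)) (g n (right {M} h))

fromℚ : ℚ → ℝ
fromℚ q .seq _ = q
fromℚ q .cauchy ε 0<ε = 0 , λ _ _ _ _ → dist-refl q 0<ε

infixl 6 _+ᵣ_
infixl 7 _*ᵣ_
infix  8 -ᵣ_

_+ᵣ_ : ℝ → ℝ → ℝ
(x +ᵣ y) .seq n = seq x n +q seq y n
(x +ᵣ y) .cauchy ε 0<ε =
  let M , f = cauchy x (½ *q ε) (half-pos 0<ε)
      N , g = cauchy y (½ *q ε) (half-pos 0<ε)
  in M ℕ.⊔ N , λ m n h k →
     dist-+ (seq x m) (seq y m) (seq x n) (seq y n)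
       (f m n (left h) (left k)) (g m n (right {M} h) (right {M} k))

-ᵣ_ : ℝ → ℝ
(-ᵣ x) .seq n = -q seq x n
(-ᵣ x) .cauchy ε 0<ε =
  proj₁ (cauchy x ε 0<ε) , λ m n h k →
  subst (_< ε) (sym (dist-neg (seq x m) (seq x n))) (proj₂ (cauchy x ε 0<ε) m n h k)

_*ᵣ_ : ℝ → ℝ → ℝ
(x *ᵣ y) .seq n = seq x n *q seq y n
(x *ᵣ y) .cauchy ε 0<ε =
  let A , 0<A , K , a = eventually-bounded x
      B , 0<B , L , b = eventually-bounded y
      δ , 0<δ , eA = scaled A 0<A 0<ε
      δ′ , 0<δ′ , eB = scaled B 0<B 0<ε
      M , f = cauchy y δ 0<δ
      N , g = cauchy x δ′ 0<δ′
  in (K ℕ.⊔ L) ℕ.⊔ (M ℕ.⊔ N) , λ m n h k →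
     dist-* (seq x m) (seq y m) (seq x n) (seq y n) 0<A 0<B eA eB
       (a m (left (left h))) (b n (right {K} (left k)))
       (f m n (left (right {K ℕ.⊔ L} h)) (left (right {K ℕ.⊔ L} k)))
       (g m n (right {M} (right {K ℕ.⊔ L} h)) (right {M} (right {K ℕ.⊔ L} k)))

private
  +-cong : ∀ {x y u v} → x ≈ y → u ≈ v → x +ᵣ u ≈ y +ᵣ v
  +-cong {x} {y} {u} {v} (mk≈ p) (mk≈ q) = mk≈ λ ε 0<ε →
    let M , f = p (½ *q ε) (half-pos 0<ε)
        N , g = q (½ *q ε) (half-pos 0<ε)
    in M ℕ.⊔ N , λ n h →
       dist-+ (seq x n) (seq u n) (seq y n) (seq v n) (f n (left h)) (g n (right {M} h))

  -‿cong : ∀ {x y} → x ≈ y → -ᵣ x ≈ -ᵣ y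
  -‿cong {x} {y} (mk≈ p) = mk≈ λ ε 0<ε → proj₁ (p ε 0<ε) , λ n h →
    subst (_< ε) (sym (dist-neg (seq x n) (seq y n))) (proj₂ (p ε 0<ε) n h)

  *-cong : ∀ {x y u v} → x ≈ y → u ≈ v → x *ᵣ u ≈ y *ᵣ v
  *-cong {x} {y} {u} {v} (mk≈ p) (mk≈ q) = mk≈ λ ε 0<ε →
    let A , 0<A , K , a = eventually-bounded x
        B , 0<B , L , b = eventually-bounded v
        δ , 0<δ , eA = scaled A 0<A 0<ε
        δ′ , 0<δ′ , eB = scaled B 0<B 0<ε
        M , f = q δ 0<δ
        N , g = p δ′ 0<δ′
    in (K ℕ.⊔ L) ℕ.⊔ (M ℕ.⊔ N) , λ n h →
       dist-* (seq x n) (seq u n) (seq y n) (seq v n) 0<A 0<B eA eB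
         (a n (left (left h))) (b n (right {K} (left h)))
         (f n (left (right {K ℕ.⊔ L} h))) (g n (right {M} (right {K ℕ.⊔ L} h)))

-- The ring laws hold termwise, hence up to _≈_.
ℝ-commutativeRing : CommutativeRing 0ℓ 0ℓ
ℝ-commutativeRing = record
  { Carrier = ℝ
  ; _≈_ = _≈_
  ; _+_ = _+ᵣ_
  ; _*_ = _*ᵣ_
  ; -_ = -ᵣ_
  ; 0# = fromℚ 0ℚ
  ; 1# = fromℚ 1ℚ
  ; isCommutativeRing = record
    { isRing = record
      { +-isAbelianGroup = record
        { isGroup = record
          { isMonoid = record
            { isSemigroup = record
              { isMagma = record
                { isEquivalence = record
                  { refl = pointwise (λ _ → refl) ; sym = ≈-sym ; trans = ≈-trans }
                ; ∙-cong = +-cong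
                }
              ; assoc = λ x y z → pointwise λ n → ℚ.+-assoc (seq x n) (seq y n) (seq z n)
              }
            ; identity = (λ x → pointwise λ n → ℚ.+-identityˡ (seq x n))
                       , (λ x → pointwise λ n → ℚ.+-identityʳ (seq x n))
            }
          ; inverse = (λ x → pointwise λ n → ℚ.+-inverseˡ (seq x n))
                    , (λ x → pointwise λ n → ℚ.+-inverseʳ (seq x n))
          ; ⁻¹-cong = -‿cong
          }
        ; comm = λ x y → pointwise λ n → ℚ.+-comm (seq x n) (seq y n)
        }
      ; *-cong = *-cong
      ; *-assoc = λ x y z → pointwise λ n → ℚ.*-assoc (seq x n) (seq y n) (seq z n)
      ; *-identity = (λ x → pointwise λ n → ℚ.*-identityˡ (seq x n))
                   , (λ x → pointwise λ n → ℚ.*-identityʳ (seq x n))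
      ; distrib = (λ x y z → pointwise λ n → ℚ.*-distribˡ-+ (seq x n) (seq y n) (seq z n))
                , (λ x y z → pointwise λ n → ℚ.*-distribʳ-+ (seq x n) (seq y n) (seq z n))
      }
    ; *-comm = λ x y → pointwise λ n → ℚ.*-comm (seq x n) (seq y n)
    }
  }

private
  power : ∀ {r ℓ} (R : CommutativeRing r ℓ) → ℕ → Module R r ℓ
  power R n = record
    { Carrierᴹ = Vector Carrier n
    ; _≈ᴹ_ = λ u v → ∀ i → u i ≈ᴿ v i
    ; _+ᴹ_ = λ u v i → u i + v i
    ; _*ₗ_ = λ a v i → a * v i
    ; _*ᵣ_ = λ v a i → a * v i
    ; 0ᴹ = λ _ → 0#
    ; -ᴹ_ = λ v i → - v i
    ; isModule = IsModuleFromLeft.isModule {commutativeRing = R} record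
      { isLeftModule = record
        { isLeftSemimodule = record
          { +ᴹ-isCommutativeMonoid =
              Pointwise.isCommutativeMonoid (Fin n) +-isCommutativeMonoid
          ; isPreleftSemimodule = record
            { *ₗ-cong = λ p q i → *-congᴿ p (q i)
            ; *ₗ-zeroˡ = λ v i → zeroˡ (v i)
            ; *ₗ-distribʳ = λ v a b i → distribʳ (v i) a b
            ; *ₗ-identityˡ = λ v i → *-identityˡ (v i)
            ; *ₗ-assoc = λ a b v i → *-assoc a b (v i)
            ; *ₗ-zeroʳ = λ a i → zeroʳ a
            ; *ₗ-distribˡ = λ a u v i → distribˡ a (u i) (v i)
            }
          }
        ; -ᴹ‿cong = λ p i → -‿congᴿ (p i)
        ; -ᴹ‿inverse = (λ v i → -‿inverseˡ (v i)) , (λ v i → -‿inverseʳ (v i))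
        }
      }
    }
    where
    open CommutativeRing R
      renaming (_≈_ to _≈ᴿ_; *-cong to *-congᴿ; -‿cong to -‿congᴿ)
      hiding (refl; sym; trans)

ℝ^_ : ℕ → Module ℝ-commutativeRing 0ℓ 0ℓ
ℝ^ n = power ℝ-commutativeRing n

IsLinear : ∀ m n → (Vector ℝ m → Vector ℝ n) → Set
IsLinear m n = IsModuleHomomorphism
  where
  open ModuleMorphisms.ModuleMorphisms
    (Module.rawModule (ℝ^ m)) (Module.rawModule (ℝ^ n)) using (IsModuleHomomorphism)

Ker : ∀ {m n} → (Vector ℝ m → Vector ℝ n) → Pred (Vector ℝ m) 0ℓ
Ker {m} {n} ρ v = Module._≈ᴹ_ (ℝ^ n) (ρ v) (Module.0ᴹ (ℝ^ n))

record IsSubspace {ℓ} n (S : Pred (Vector ℝ n) ℓ) : Set ℓ where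
  open Module (ℝ^ n)
  field
    respects  : ∀ {u v} → u ≈ᴹ v → u ∈ S → v ∈ S
    0ᴹ-closed : 0ᴹ ∈ S
    +ᴹ-closed : ∀ {u v} → u ∈ S → v ∈ S → u +ᴹ v ∈ S
    *ₗ-closed : ∀ a {v} → v ∈ S → a *ₗ v ∈ S

ι : ∀ {n} → Vector ℤ n → Vector ℝ n
ι x i = fromℚ (fromℤ (x i))

-- S ∩ ℤⁿ, as a set of integer vectors.
_∩ℤ : ∀ {ℓ n} → Pred (Vector ℝ n) ℓ → Pred (Vector ℤ n) ℓ
(S ∩ℤ) x = ι x ∈ S

Matrix : ℕ → ℕ → Set
Matrix N J = Vector (Vector ℤ J) N

open RawMonoidDefinitions ℤ.+-0-rawMonoid public using (sum)

column : ∀ {N J} → Matrix N J → Fin J → Vector ℤ N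
column X j i = X i j

_·_ : ∀ {N J} → Matrix N J → Vector ℤ J → Vector ℤ N
(X · c) i = sum λ j → X i j ℤ.* c j

-- The columns of X form a ℤ-basis of Λ, so that J is the rank of Λ.
record IsBasis {ℓ N J} (Λ : Pred (Vector ℤ N) ℓ) (X : Matrix N J) : Set ℓ where
  field
    columns-in  : ∀ j → column X j ∈ Λ
    generating  : ∀ x → x ∈ Λ → ∃ λ c → X · c ≗ x
    independent : ∀ c → X · c ≗ (λ _ → 0ℤ) → c ≗ (λ _ → 0ℤ)

height : ∀ {N} → Vector ℤ N → ℕ
height x = Vector.foldr ℕ._⊔_ 0 (ℤ.∣_∣ ∘ x)

-- Laplace expansion along the first row.
det : ∀ {n} → Matrix n n → ℤ
det {zero}  A = 1ℤ
det {suc n} A = sum λ j →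
  (-1ℤ ℤ.^ toℕ j) ℤ.* A zero j ℤ.* det (λ i → removeAt (A (suc i)) j)

-- The J-element subsets of {1,…,N}, each listed in increasing order.
subsets : ∀ J N → List (Vector (Fin N) J)
subsets zero    N       = [ (λ ()) ]
subsets (suc J) zero    = []
subsets (suc J) (suc N) =
  List.map (λ I → zero Vector.∷ suc ∘ I) (subsets J N) ++
  List.map (suc ∘_) (subsets (suc J) N)

-- The height of the lattice with basis matrix X; X ∘ I is the submatrix X_I.
-- The value does not depend on the basis chosen.
latticeHeight : ∀ {N J} → Matrix N J → ℕ
latticeHeight {N} {J} X = max 0 (List.map (λ I → ℤ.∣ det (X ∘ I) ∣) (subsets J N))

fromℕ : ℕ → ℚ
fromℕ n = fromℤ (+ n)

-- 2 Jᴶ (3/2)ᴶ⁻¹ + J; only J ≥ 1 matters, where truncated subtraction is exact.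
constant : ℕ → ℚ
constant J = fromℕ (2 ℕ.* J ℕ.^ J) *q ((+ 3 ℚ./ 2) ^ (J ℕ.∸ 1)) +q fromℕ J
  where open RawSemiringDefinitions ℚ.+-*-rawSemiring using (_^_)

{-# OPTIONS --safe #-}

-- The constant 1 already suffices when J ≥ 1.  For a list K of J − 1 rows let
-- x_K be the vector whose r-th entry is the determinant of rows r, K of X.
-- Expanding along the row r puts x_K in Ω, and its entries are, up to sign,
-- maximal minors of X or zero, so H(x_K) ≤ H(Ω).  If d = det X_I ≠ 0, Cramer's
-- rule writes d times each column of X as an integer combination of vectors
-- x_K with K ⊂ I; so if every x_K were in U₀, then Ω would be contained in U₀.

module Submission where

open import Algebra.Bundles using (CommutativeRing)
open import Algebra.Module.Bundles using (Module)
import Algebra.Module.Morphism.Structures as ModuleMorphisms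
import Algebra.Definitions.RawSemiring as RawSemiringDefinitions
import Algebra.Properties.Monoid.Sum as MonoidSum
open import Axiom.ExcludedMiddle using (ExcludedMiddle)
open import Data.Empty using (⊥-elim)
open import Data.Fin.Base using (Fin; zero; suc; toℕ; punchIn)
open import Data.Fin.Properties using (any?)
open import Data.Integer.Base as ℤ using (ℤ; +_; 0ℤ; 1ℤ; -1ℤ; +[1+_]; -[1+_])
import Data.Integer.Properties as ℤ
open import Data.Integer.Tactic.RingSolver using (solve-∀)
open import Data.List.Base as List
  using (List; []; _∷_; _++_; length; tabulate; allFin)
open import Data.List.Extrema.Nat using (xs≤max)
open import Data.List.Membership.Propositional.Properties using (∈-∃++; ∈-allFin)
open import Data.List.Properties
  using (length-++-sucʳ; length-map; length-tabulate; map-++; map-tabulate)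
open import Data.List.Relation.Unary.All as All using (All; []; _∷_)
import Data.List.Relation.Unary.All.Properties as All
open import Data.Nat.Base as ℕ using (ℕ; zero; suc; z≤n)
import Data.Nat.Properties as ℕ
open import Data.Product.Base using (∃; ∃₂; _×_; _,_; proj₁; proj₂)
open import Data.Rational.Base as ℚ using (ℚ; 1ℚ; 1/_; _*_; _≤_)
open import Data.Rational.Literals using (fromℤ)
import Data.Rational.Properties as ℚ
import Data.Rational.Unnormalised.Base as ℚᵘ
import Data.Rational.Unnormalised.Properties as ℚᵘ
open import Data.Sum.Base using (_⊎_; inj₁; inj₂)
open import Data.Vec.Functional as Vector using (Vector)
open import Function.Base using (_∘_; _$_; flip; id)
open import Level using (Level)
open import Relation.Binary.PropositionalEquality
  using (_≡_; _≢_; _≗_; refl; sym; trans; cong; cong₂; subst; module ≡-Reasoning)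
open import Relation.Nullary using (yes; no; ¬?)
open import Relation.Nullary.Decidable using (decidable-stable)
open import Relation.Unary using (Pred; _∈_; _∉_; _⊆_; _⊈_)
open import Defs

private
  variable
    ℓ : Level
    A B : Set

-- Alternating functions on lists

-- Only adjacent swaps occur, in lists of every length, so the property survives fixing a head, as
-- inductions on lists require.
Alternating : (List A → ℤ) → Set _
Alternating f = ∀ xs a b ys → f (xs ++ a ∷ b ∷ ys) ≡ ℤ.- f (xs ++ b ∷ a ∷ ys)

alternating-∷ : (f : List A → ℤ) (x : A) → Alternating f → Alternating (f ∘ (x ∷_))
alternating-∷ f x alt xs = alt (x ∷ xs)

alternating-map : (f : List B → ℤ) (g : A → B) → Alternating f → Alternating (f ∘ List.map g)
alternating-map f g alt xs a b ys = begin
  f (List.map g (xs ++ a ∷ b ∷ ys))                      ≡⟨ cong f (map-++ g xs _) ⟩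
  f (List.map g xs ++ g a ∷ g b ∷ List.map g ys)         ≡⟨ alt (List.map g xs) (g a) (g b) _ ⟩
  ℤ.- f (List.map g xs ++ g b ∷ g a ∷ List.map g ys)     ≡⟨ cong (ℤ.-_ ∘ f) (map-++ g xs _) ⟨
  ℤ.- f (List.map g (xs ++ b ∷ a ∷ ys))                  ∎
  where open ≡-Reasoning

-- Each swap that carries `a` past an entry of `xs` flips the sign; absolute values avoid tracking
-- the parity.
alternating-front : (f : List A → ℤ) → Alternating f → ∀ xs a ys →
                    ℤ.∣ f (xs ++ a ∷ ys) ∣ ≡ ℤ.∣ f (a ∷ xs ++ ys) ∣
alternating-front f alt [] a ys = refl
alternating-front f alt (x ∷ xs) a ys = begin
  ℤ.∣ f (x ∷ xs ++ a ∷ ys) ∣         ≡⟨ alternating-front (f ∘ (x ∷_)) (alternating-∷ f x alt) xs a ys ⟩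
  ℤ.∣ f (x ∷ a ∷ xs ++ ys) ∣         ≡⟨ cong ℤ.∣_∣ (alt [] x a (xs ++ ys)) ⟩
  ℤ.∣ ℤ.- f (a ∷ x ∷ xs ++ ys) ∣     ≡⟨ ℤ.∣-i∣≡∣i∣ (f (a ∷ x ∷ xs ++ ys)) ⟩
  ℤ.∣ f (a ∷ x ∷ xs ++ ys) ∣         ∎
  where open ≡-Reasoning

i≡-i⇒i≡0 : ∀ {i} → i ≡ ℤ.- i → i ≡ 0ℤ
i≡-i⇒i≡0 {+ zero}   _ = refl
i≡-i⇒i≡0 {+[1+ _ ]} ()
i≡-i⇒i≡0 { -[1+ _ ]} ()

-- Once the second `a` is moved next to the first, swapping the two equal neighbours gives i = -i.
alternating-repeat : (f : List A → ℤ) → Alternating f → ∀ a xs ys → f (a ∷ xs ++ a ∷ ys) ≡ 0ℤ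
alternating-repeat f alt a xs ys = ℤ.∣i∣≡0⇒i≡0 (begin
  ℤ.∣ f (a ∷ xs ++ a ∷ ys) ∣     ≡⟨ alternating-front (f ∘ (a ∷_)) (alternating-∷ f a alt) xs a ys ⟩
  ℤ.∣ f (a ∷ a ∷ xs ++ ys) ∣     ≡⟨ cong ℤ.∣_∣ (i≡-i⇒i≡0 (alt [] a a (xs ++ ys))) ⟩
  0                              ∎)
  where open ≡-Reasoning

-- Mirrors the recursion of `subsets`, where `zero` is either put first or left out.
map-suc⊎zero : ∀ {n} (xs : List (Fin (suc n))) →
               (∃ λ ys → xs ≡ List.map suc ys) ⊎ (∃₂ λ ys zs → xs ≡ ys ++ zero ∷ zs)
map-suc⊎zero [] = inj₁ ([] , refl)
map-suc⊎zero (zero ∷ xs) = inj₂ ([] , xs , refl)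
map-suc⊎zero (suc x ∷ xs) with map-suc⊎zero xs
... | inj₁ (ys , refl)      = inj₁ (x ∷ ys , refl)
... | inj₂ (ys , zs , refl) = inj₂ (suc x ∷ ys , zs , refl)

-- Sorting changes only the sign and a repeated entry gives 0, so increasing lists decide the bound.
-- The induction follows `subsets`, moving `zero` to the front if it occurs.
alternating-bound : ∀ J N {h} (f : List (Fin N) → ℤ) → Alternating f →
                    All (λ I → ℤ.∣ f (tabulate I) ∣ ℕ.≤ h) (subsets J N) →
                    ∀ xs → length xs ≡ J → ℤ.∣ f xs ∣ ℕ.≤ h
alternating-bound zero    N       f alt (f[]≤h ∷ []) [] _ = f[]≤h
alternating-bound (suc J) zero    f alt f≤h (() ∷ _)
alternating-bound (suc J) (suc N) {h} f alt f≤h xs ∣xs∣≡1+J with map-suc⊎zero xs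
... | inj₁ (ys , refl) =
  alternating-bound (suc J) N (f ∘ List.map suc) (alternating-map f suc alt)
    (All.map (λ {I} → subst (λ zs → ℤ.∣ f zs ∣ ℕ.≤ h) (sym (map-tabulate I suc)))
             (All.map⁻ (All.++⁻ʳ (List.map _ (subsets J N)) f≤h)))
    ys (trans (sym (length-map suc ys)) ∣xs∣≡1+J)
... | inj₂ (ys , zs , refl) rewrite alternating-front f alt ys zero zs
  with ∣ys++zs∣≡J ← ℕ.suc-injective (trans (sym (length-++-sucʳ ys zero zs)) ∣xs∣≡1+J)
  with ys ++ zs | map-suc⊎zero (ys ++ zs)
... | _ | inj₁ (ws , refl) =
  alternating-bound J N (f ∘ (zero ∷_) ∘ List.map suc)
    (alternating-map (f ∘ (zero ∷_)) suc (alternating-∷ f zero alt))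
    (All.map (λ {I} → subst (λ zs → ℤ.∣ f (zero ∷ zs) ∣ ℕ.≤ h) (sym (map-tabulate I suc)))
             (All.map⁻ (All.++⁻ˡ (List.map _ (subsets J N)) f≤h)))
    ws (trans (sym (length-map suc ws)) ∣ys++zs∣≡J)
-- A second `zero` is left in the tail, so the value vanishes.
... | _ | inj₂ (us , vs , refl) rewrite alternating-repeat f alt zero us vs = z≤n

-- Determinants over lists of rows and columns

-- Σₖ (−1)ᵏ h(bₖ) f(b with bₖ removed)
expand : (B → ℤ) → (List B → ℤ) → List B → ℤ
expand h f []       = 0ℤ
expand h f (b ∷ bs) = h b ℤ.* f bs ℤ.- expand h (f ∘ (b ∷_)) bs

expand-cong : ∀ (h : B → ℤ) {f g} → f ≗ g → expand h f ≗ expand h g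
expand-cong h f≗g []       = refl
expand-cong h f≗g (b ∷ bs) =
  cong₂ (λ i j → h b ℤ.* i ℤ.- j) (f≗g bs) (expand-cong h (f≗g ∘ (b ∷_)) bs)

expand-neg : ∀ (h : B → ℤ) f bs → expand h (ℤ.-_ ∘ f) bs ≡ ℤ.- expand h f bs
expand-neg h f []       = refl
expand-neg h f (b ∷ bs) = begin
  h b ℤ.* ℤ.- f bs ℤ.- expand h (ℤ.-_ ∘ f ∘ (b ∷_)) bs   ≡⟨ cong (λ i → h b ℤ.* ℤ.- f bs ℤ.- i) (expand-neg h (f ∘ (b ∷_)) bs) ⟩
  h b ℤ.* ℤ.- f bs ℤ.- ℤ.- expand h (f ∘ (b ∷_)) bs      ≡⟨ identity (h b) (f bs) (expand h (f ∘ (b ∷_)) bs) ⟩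
  ℤ.- (h b ℤ.* f bs ℤ.- expand h (f ∘ (b ∷_)) bs)        ∎
  where
  open ≡-Reasoning
  identity : ∀ h f e → h ℤ.* ℤ.- f ℤ.- ℤ.- e ≡ ℤ.- (h ℤ.* f ℤ.- e)
  identity = solve-∀

expand-zero : ∀ (h : B → ℤ) bs → expand h (λ _ → 0ℤ) bs ≡ 0ℤ
expand-zero h []       = refl
expand-zero h (b ∷ bs) = cong₂ ℤ._-_ (ℤ.*-zeroʳ (h b)) (expand-zero h bs)

-- The shape `c ℤ.* f zs ℤ.- g zs` is that of one unfolding of an inner `expand`, as met in
-- `expand-comm`.
expand-linear : ∀ (h : B → ℤ) c f g bs →
  expand h (λ zs → c ℤ.* f zs ℤ.- g zs) bs ≡ c ℤ.* expand h f bs ℤ.- expand h g bs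
expand-linear h c f g []       = sym (cong (ℤ._- 0ℤ) (ℤ.*-zeroʳ c))
expand-linear h c f g (b ∷ bs) = trans
  (cong (λ i → h b ℤ.* (c ℤ.* f bs ℤ.- g bs) ℤ.- i) (expand-linear h c (f ∘ (b ∷_)) (g ∘ (b ∷_)) bs))
  (identity (h b) c (f bs) (g bs) (expand h (f ∘ (b ∷_)) bs) (expand h (g ∘ (b ∷_)) bs))
  where
  identity : ∀ h c f g e k → h ℤ.* (c ℤ.* f ℤ.- g) ℤ.- (c ℤ.* e ℤ.- k)
                           ≡ c ℤ.* (h ℤ.* f ℤ.- e) ℤ.- (h ℤ.* g ℤ.- k)
  identity = solve-∀

-- Both sides are the same signed double sum, over one entry removed from each list.
expand-comm : ∀ (h : B → ℤ) (k : A → ℤ) (f : List A → List B → ℤ) as bs →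
  expand h (λ zs → expand k (flip f zs) as) bs ≡ expand k (λ ws → expand h (f ws) bs) as
expand-comm h k f []       bs = expand-zero h bs
expand-comm h k f (a ∷ as) bs = trans
  (expand-linear h (k a) (f as) (λ zs → expand k (λ ws → f (a ∷ ws) zs) as) bs)
  (cong (λ i → k a ℤ.* expand h (f as) bs ℤ.- i) (expand-comm h k (f ∘ (a ∷_)) as bs))

-- The two terms that remove `a` or `b` have opposite signs and trade places; the later terms keep
-- both entries, so there `f` itself alternates.
expand-alternating : ∀ (h : B → ℤ) f → Alternating f → Alternating (expand h f)
expand-alternating h f alt [] a b ys = begin
  h a ℤ.* f (b ∷ ys) ℤ.- (h b ℤ.* f (a ∷ ys) ℤ.- expand h (f ∘ (a ∷_) ∘ (b ∷_)) ys)
    ≡⟨ cong (λ i → h a ℤ.* f (b ∷ ys) ℤ.- (h b ℤ.* f (a ∷ ys) ℤ.- i))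
         (trans (expand-cong h (alt [] a b) ys) (expand-neg h (f ∘ (b ∷_) ∘ (a ∷_)) ys)) ⟩
  h a ℤ.* f (b ∷ ys) ℤ.- (h b ℤ.* f (a ∷ ys) ℤ.- ℤ.- expand h (f ∘ (b ∷_) ∘ (a ∷_)) ys)
    ≡⟨ identity (h a ℤ.* f (b ∷ ys)) (h b ℤ.* f (a ∷ ys)) (expand h (f ∘ (b ∷_) ∘ (a ∷_)) ys) ⟩
  ℤ.- (h b ℤ.* f (a ∷ ys) ℤ.- (h a ℤ.* f (b ∷ ys) ℤ.- expand h (f ∘ (b ∷_) ∘ (a ∷_)) ys)) ∎
  where
  open ≡-Reasoning
  identity : ∀ i j e → i ℤ.- (j ℤ.- ℤ.- e) ≡ ℤ.- (j ℤ.- (i ℤ.- e))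
  identity = solve-∀
expand-alternating h f alt (x ∷ xs) a b ys = trans
  (cong₂ (λ i j → h x ℤ.* i ℤ.- j) (alt xs a b ys)
    (expand-alternating h (f ∘ (x ∷_)) (alternating-∷ f x alt) xs a b ys))
  (identity (h x) (f (xs ++ b ∷ a ∷ ys)) (expand h (f ∘ (x ∷_)) (xs ++ b ∷ a ∷ ys)))
  where
  identity : ∀ h f e → h ℤ.* ℤ.- f ℤ.- ℤ.- e ≡ ℤ.- (h ℤ.* f ℤ.- e)
  identity = solve-∀

-- The value is 0 when the two lists differ in length.
listDet : (A → B → ℤ) → List A → List B → ℤ
listDet p []       []      = 1ℤ
listDet p []       (_ ∷ _) = 0ℤ
listDet p (a ∷ as) bs      = expand (p a) (listDet p as) bs

listDet-alternating : ∀ (p : A → B → ℤ) as → Alternating (listDet p as)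
listDet-alternating p []       []      a b ys = refl
listDet-alternating p []       (_ ∷ _) a b ys = refl
listDet-alternating p (a ∷ as) = expand-alternating (p a) (listDet p as) (listDet-alternating p as)

-- Expand along the first row, then the smaller determinants along their first column by induction;
-- `expand-comm` interchanges the two sums.
listDet-expandColumn : ∀ (p : A → B → ℤ) as b bs →
  listDet p as (b ∷ bs) ≡ expand (flip p b) (λ ws → listDet p ws bs) as
listDet-expandColumn p []       b bs = refl
listDet-expandColumn p (a ∷ as) b bs = cong (λ i → p a b ℤ.* listDet p as bs ℤ.- i) (trans
  (expand-cong (p a) (listDet-expandColumn p as b) bs)
  (expand-comm (p a) (flip p b) (listDet p) as bs))

-- Column expansion is the defining row expansion of the transposed array. This carries alternation
-- from columns over to rows.
listDet-transpose : ∀ (p : A → B → ℤ) as bs → listDet p as bs ≡ listDet (flip p) bs as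
listDet-transpose p []       []       = refl
listDet-transpose p (_ ∷ _)  []       = refl
listDet-transpose p as       (b ∷ bs) = trans
  (listDet-expandColumn p as b bs)
  (expand-cong (flip p b) (λ ws → listDet-transpose p ws bs) as)

-- Agreement with the Laplace determinant `det`

open MonoidSum ℤ.+-0-monoid using (sum-cong-≗)

sum-neg : ∀ {n} {s t : Vector ℤ n} → (∀ j → s j ≡ ℤ.- t j) → sum s ≡ ℤ.- sum t
sum-neg {zero}          _    = refl
sum-neg {suc n} {s} {t} s≡-t = trans
  (cong₂ ℤ._+_ (s≡-t zero) (sum-neg (s≡-t ∘ suc)))
  (sym (ℤ.neg-distrib-+ (t zero) (sum (t ∘ suc))))

-- The nested subtractions of `expand` unroll to the signs (-1)^j, and deleting entry j of a
-- tabulation is precomposition with `punchIn j`.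
expand-tabulate : ∀ {n} (h : B → ℤ) f (c : Fin (suc n) → B) →
  expand h f (tabulate c) ≡
  sum λ j → (-1ℤ ℤ.^ toℕ j) ℤ.* h (c j) ℤ.* f (tabulate (c ∘ punchIn j))
expand-tabulate {n = zero} h f c = identity (h (c zero)) (f [])
  where
  identity : ∀ h f → h ℤ.* f ℤ.- 0ℤ ≡ 1ℤ ℤ.* h ℤ.* f ℤ.+ 0ℤ
  identity = solve-∀
expand-tabulate {n = suc n} h f c = cong₂ ℤ._+_
  (cong (ℤ._* f (tabulate (c ∘ suc))) (sym (ℤ.*-identityˡ (h (c zero)))))
  (trans (cong ℤ.-_ (expand-tabulate h (f ∘ (c zero ∷_)) (c ∘ suc)))
         (sym (sum-neg λ j → identity (-1ℤ ℤ.^ toℕ j) (h (c (suc j)))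
                                      (f (tabulate (c ∘ punchIn (suc j)))))))
  where
  identity : ∀ s h f → -1ℤ ℤ.* s ℤ.* h ℤ.* f ≡ ℤ.- (s ℤ.* h ℤ.* f)
  identity = solve-∀

det≡listDet : ∀ {n} (p : A → B → ℤ) (r : Fin n → A) (c : Fin n → B) →
              det (λ i j → p (r i) (c j)) ≡ listDet p (tabulate r) (tabulate c)
det≡listDet {n = zero}  p r c = refl
det≡listDet {n = suc n} p r c = trans
  (sum-cong-≗ λ j → cong ((-1ℤ ℤ.^ toℕ j) ℤ.* p (r zero) (c j) ℤ.*_)
    (det≡listDet p (r ∘ suc) (c ∘ punchIn j)))
  (sym (expand-tabulate (p (r zero)) (listDet p (tabulate (r ∘ suc))) c))

-- Maximal minors

-- Rows form a list in any order, repetitions allowed, so that `r ∷ rs` is available for every row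
-- `r`, even one already in `rs`.
minor : ∀ {N J} → Matrix N J → List (Fin N) → ℤ
minor {J = J} X rs = listDet X rs (allFin J)

minor-alternating : ∀ {N J} (X : Matrix N J) → Alternating (minor X)
minor-alternating {J = J} X xs a b ys = begin
  minor X (xs ++ a ∷ b ∷ ys)                            ≡⟨ listDet-transpose X (xs ++ a ∷ b ∷ ys) (allFin J) ⟩
  listDet (flip X) (allFin J) (xs ++ a ∷ b ∷ ys)        ≡⟨ listDet-alternating (flip X) (allFin J) xs a b ys ⟩
  ℤ.- listDet (flip X) (allFin J) (xs ++ b ∷ a ∷ ys)    ≡⟨ cong ℤ.-_ (listDet-transpose X (xs ++ b ∷ a ∷ ys) (allFin J)) ⟨
  ℤ.- minor X (xs ++ b ∷ a ∷ ys)                        ∎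
  where open ≡-Reasoning

∣minor∣≤latticeHeight : ∀ {N J} (X : Matrix N J) rs → length rs ≡ J →
                        ℤ.∣ minor X rs ∣ ℕ.≤ latticeHeight X
∣minor∣≤latticeHeight {N} {J} X = alternating-bound J N (minor X) (minor-alternating X)
  (All.map (λ {I} → subst (λ i → ℤ.∣ i ∣ ℕ.≤ latticeHeight X) (det≡listDet X I id))
           (All.map⁻ (xs≤max 0 (List.map (λ I → ℤ.∣ det (X ∘ I) ∣) (subsets J N)))))

-- Cramer's rule, from a determinant in which column l occurs twice.
cramer : ∀ {N J} (X : Matrix N J) rs l r →
         minor X rs ℤ.* X r l ≡ expand (λ a → X a l) (λ zs → minor X (r ∷ zs)) rs
cramer {J = J} X rs l r with ys , zs , allFin≡ ← ∈-∃++ (∈-allFin l) = begin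
  minor X rs ℤ.* X r l                                      ≡⟨ ℤ.*-comm (minor X rs) (X r l) ⟩
  X r l ℤ.* minor X rs                                      ≡⟨ ℤ.i-j≡0⇒i≡j _ _ vanishing ⟩
  expand (λ a → X a l) (λ zs → minor X (r ∷ zs)) rs         ∎
  where
  open ≡-Reasoning
  vanishing : X r l ℤ.* minor X rs ℤ.- expand (λ a → X a l) (λ zs → minor X (r ∷ zs)) rs ≡ 0ℤ
  vanishing = begin
    -- By definition this column expansion has leading term `X r l ℤ.* minor X rs`, from which the
    -- rest is subtracted.
    expand (flip X l) (minor X) (r ∷ rs)       ≡⟨ listDet-expandColumn X (r ∷ rs) l (allFin J) ⟨
    listDet X (r ∷ rs) (l ∷ allFin J)          ≡⟨ cong (λ cs → listDet X (r ∷ rs) (l ∷ cs)) allFin≡ ⟩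
    listDet X (r ∷ rs) (l ∷ ys ++ l ∷ zs)      ≡⟨ alternating-repeat (listDet X (r ∷ rs))
                                                     (listDet-alternating X (r ∷ rs)) l ys zs ⟩
    0ℤ                                         ∎

LinearlyIndependent : ∀ {N J} → Matrix N J → Set
LinearlyIndependent X = ∀ c → X · c ≗ (λ _ → 0ℤ) → c ≗ (λ _ → 0ℤ)

-- If no row r completes a nonzero minor of the other columns to a nonzero
-- minor, then its signed cofactors are a linear relation between the columns.
nonzeroMinor : ∀ {N} J (X : Matrix N J) → LinearlyIndependent X → ∃ λ I → det (X ∘ I) ≢ 0ℤ
nonzeroMinor zero X indep = (λ ()) , λ ()
nonzeroMinor {N} (suc J) X indep
  with I , det≢0 ← nonzeroMinor J (λ i → X i ∘ suc)
         -- A relation between the later columns becomes one between all columns by giving the first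
         -- the coefficient 0.
         (λ c Xc≗0 → indep (0ℤ Vector.∷ c) (λ i → cong₂ ℤ._+_ (ℤ.*-zeroʳ (X i zero)) (Xc≗0 i)) ∘ suc)
  with any? (λ r → ¬? (det (X ∘ (r Vector.∷ I)) ℤ.≟ 0ℤ))
... | yes (r , det′≢0) = r Vector.∷ I , det′≢0
-- The cofactor at `zero` is 1 times the minor that `det≢0` makes nonzero, so the relation is
-- nontrivial.
... | no  det′≡0       = ⊥-elim (det≢0 (trans (sym (ℤ.*-identityˡ _)) (indep cofactors relation zero)))
  where
  cofactors : Vector ℤ (suc J)
  cofactors j = (-1ℤ ℤ.^ toℕ j) ℤ.* det (λ i → Vector.removeAt (X (I i)) j)
  identity : ∀ x s m → x ℤ.* (s ℤ.* m) ≡ s ℤ.* x ℤ.* m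
  identity = solve-∀
  relation : X · cofactors ≗ (λ _ → 0ℤ)
  -- Up to the order of factors, the sum is the first-row expansion of `det (X ∘ (r Vector.∷ I))`.
  relation r = trans
    (sum-cong-≗ λ j → identity (X r j) (-1ℤ ℤ.^ toℕ j) (det (λ i → Vector.removeAt (X (I i)) j)))
    (decidable-stable (_ ℤ.≟ 0ℤ) (λ det≢0 → det′≡0 (r , det≢0)))

-- Integer points of real subspaces

fromℤ-+ : ∀ i j → fromℤ (i ℤ.+ j) ≡ fromℤ i ℚ.+ fromℤ j
fromℤ-+ i j = ℚ.toℚᵘ-injective (ℚᵘ.≃-trans (ℚᵘ.*≡* (identity i j))
  (ℚᵘ.≃-sym (ℚ.toℚᵘ-homo-+ (fromℤ i) (fromℤ j))))
  where
  identity : ∀ i j → (i ℤ.+ j) ℤ.* 1ℤ ≡ (i ℤ.* 1ℤ ℤ.+ j ℤ.* 1ℤ) ℤ.* 1ℤ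
  identity = solve-∀

fromℤ-* : ∀ i j → fromℤ (i ℤ.* j) ≡ fromℤ i ℚ.* fromℤ j
fromℤ-* i j = ℚ.toℚᵘ-injective (ℚᵘ.≃-sym (ℚ.toℚᵘ-homo-* (fromℤ i) (fromℤ j)))

open CommutativeRing ℝ-commutativeRing using ()
  renaming (refl to ≈-refl; sym to ≈-sym; trans to ≈-trans; +-cong to +ᵣ-cong;
            *-congˡ to *ᵣ-congˡ; +-identityˡ to +ᵣ-identityˡ; zeroʳ to *ᵣ-zeroʳ)

≗⇒≈ : ∀ {x y} → seq x ≗ seq y → x ≈ y
≗⇒≈ {x} eq = mk≈ λ ε 0<ε → proj₁ (converge (≈-refl {x}) ε 0<ε) , λ n h →
  subst (λ q → ℚ.∣ seq x n ℚ.- q ∣ ℚ.< ε) (eq n) (proj₂ (converge (≈-refl {x}) ε 0<ε) n h)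

module _ {n} {S : Pred (Vector ℝ n) ℓ} (isSubspace : IsSubspace n S) where
  open IsSubspace isSubspace

  ∩ℤ-respects : ∀ {u v} → u ≗ v → u ∈ (S ∩ℤ) → v ∈ (S ∩ℤ)
  ∩ℤ-respects u≗v = respects (λ i → ≗⇒≈ λ _ → cong fromℤ (u≗v i))

  ∩ℤ-0 : (λ _ → 0ℤ) ∈ (S ∩ℤ)
  ∩ℤ-0 = respects (λ i → ≗⇒≈ λ _ → refl) 0ᴹ-closed

  ∩ℤ-+ : ∀ {u v} → u ∈ (S ∩ℤ) → v ∈ (S ∩ℤ) → (λ i → u i ℤ.+ v i) ∈ (S ∩ℤ)
  ∩ℤ-+ {u} {v} u∈S v∈S = respects (λ i → ≗⇒≈ λ _ → sym (fromℤ-+ (u i) (v i)))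
    (+ᴹ-closed u∈S v∈S)

  ∩ℤ-* : ∀ c {v} → v ∈ (S ∩ℤ) → (λ i → c ℤ.* v i) ∈ (S ∩ℤ)
  ∩ℤ-* c {v} v∈S = respects (λ i → ≗⇒≈ λ _ → sym (fromℤ-* c (v i)))
    (*ₗ-closed (fromℚ (fromℤ c)) v∈S)

  ∩ℤ-- : ∀ {u v} → u ∈ (S ∩ℤ) → v ∈ (S ∩ℤ) → (λ i → u i ℤ.- v i) ∈ (S ∩ℤ)
  ∩ℤ-- {u} {v} u∈S v∈S = ∩ℤ-respects (λ i → cong (λ j → u i ℤ.+ j) (ℤ.-1*i≡-i (v i)))
    (∩ℤ-+ u∈S (∩ℤ-* -1ℤ v∈S))

  -- `S` is closed under real scalars, so it may be scaled by 1/c; a mere subgroup of integer points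
  -- could fail here.
  ∩ℤ-cancel : ∀ c → c ≢ 0ℤ → ∀ {v} → (λ i → c ℤ.* v i) ∈ (S ∩ℤ) → v ∈ (S ∩ℤ)
  ∩ℤ-cancel c c≢0 {v} cv∈S = respects (λ i → ≗⇒≈ λ _ → eq i) (*ₗ-closed (fromℚ (1/ fromℤ c)) cv∈S)
    where
    instance
      fromℤ-nonZero : ℚ.NonZero (fromℤ c)
      fromℤ-nonZero = ℤ.≢-nonZero c≢0
    open ≡-Reasoning
    eq : ∀ i → 1/ fromℤ c * fromℤ (c ℤ.* v i) ≡ fromℤ (v i)
    eq i = begin
      1/ fromℤ c * fromℤ (c ℤ.* v i)           ≡⟨ cong (1/ fromℤ c *_) (fromℤ-* c (v i)) ⟩
      1/ fromℤ c * (fromℤ c * fromℤ (v i))     ≡⟨ ℚ.*-assoc (1/ fromℤ c) (fromℤ c) (fromℤ (v i)) ⟨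
      1/ fromℤ c * fromℤ c * fromℤ (v i)       ≡⟨ cong (_* fromℤ (v i)) (ℚ.*-inverseˡ (fromℤ c)) ⟩
      1ℚ * fromℤ (v i)                         ≡⟨ ℚ.*-identityˡ (fromℤ (v i)) ⟩
      fromℤ (v i)                              ∎

  ∩ℤ-· : ∀ {J} (X : Matrix n J) c → (∀ j → column X j ∈ (S ∩ℤ)) → X · c ∈ (S ∩ℤ)
  ∩ℤ-· {zero}  X c X∈S = ∩ℤ-0
  ∩ℤ-· {suc J} X c X∈S = ∩ℤ-+
    (∩ℤ-respects (λ i → ℤ.*-comm (c zero) (X i zero)) (∩ℤ-* (c zero) (X∈S zero)))
    (∩ℤ-· (λ i → X i ∘ suc) (c ∘ suc) (X∈S ∘ suc))

  -- `expand` is a signed sum of the products in the hypothesis. Either factor may carry the vector: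
  -- `h` in `minors∈`, `f` in `columns∈`.
  ∩ℤ-expand : ∀ (h : B → Vector ℤ n) (f : List B → Vector ℤ n) bs →
    (∀ b zs → suc (length zs) ≡ length bs → (λ i → h b i ℤ.* f zs i) ∈ (S ∩ℤ)) →
    (λ i → expand (λ b → h b i) (λ zs → f zs i) bs) ∈ (S ∩ℤ)
  ∩ℤ-expand h f []       hf∈S = ∩ℤ-0
  ∩ℤ-expand h f (b ∷ bs) hf∈S = ∩ℤ-- (hf∈S b bs refl)
    (∩ℤ-expand h (f ∘ (b ∷_)) bs (λ b′ zs → hf∈S b′ (b ∷ zs) ∘ cong suc))

ker-isSubspace : ∀ {m n} {ρ : Vector ℝ m → Vector ℝ n} → IsLinear m n ρ → IsSubspace m (Ker ρ)
ker-isSubspace {m} {n} {ρ} linear = record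
  { respects  = λ u≈v ρu≈0 i → ≈-trans (≈-sym (⟦⟧-cong u≈v i)) (ρu≈0 i)
  ; 0ᴹ-closed = 0ᴹ-homo
  ; +ᴹ-closed = λ {u} {v} ρu≈0 ρv≈0 i →
      ≈-trans (+ᴹ-homo u v i) (≈-trans (+ᵣ-cong (ρu≈0 i) (ρv≈0 i)) (+ᵣ-identityˡ _))
  ; *ₗ-closed = λ a {v} ρv≈0 i →
      ≈-trans (*ₗ-homo a v i) (≈-trans (*ᵣ-congˡ (ρv≈0 i)) (*ᵣ-zeroʳ a))
  }
  where
  open ModuleMorphisms.ModuleMorphisms
    (Module.rawModule (ℝ^ m)) (Module.rawModule (ℝ^ n)) using (module IsModuleHomomorphism)
  open IsModuleHomomorphism linear

-- Vectors of maximal minors in a subspace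

module _ {N J} {S : Pred (Vector ℝ N) ℓ} (isSubspace : IsSubspace N S) (X : Matrix N (suc J)) where

  -- In the expansion along row `r` the cofactors depend only on `rs`, so the same integer
  -- combination of columns serves every coordinate.
  minors∈ : (∀ j → column X j ∈ (S ∩ℤ)) → ∀ rs → (λ r → minor X (r ∷ rs)) ∈ (S ∩ℤ)
  minors∈ X∈S rs = ∩ℤ-expand isSubspace (column X) (λ cs _ → listDet X rs cs) (allFin (suc J))
    λ j cs _ → ∩ℤ-respects isSubspace (λ r → ℤ.*-comm (listDet X rs cs) (X r j))
                 (∩ℤ-* isSubspace (listDet X rs cs) (X∈S j))

  columns∈ : LinearlyIndependent X →
             (∀ rs → length rs ≡ J → (λ r → minor X (r ∷ rs)) ∈ (S ∩ℤ)) →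
             ∀ j → column X j ∈ (S ∩ℤ)
  columns∈ indep minors∈S j with I , det≢0 ← nonzeroMinor (suc J) X indep =
    ∩ℤ-cancel isSubspace (minor X rs) (det≢0 ∘ trans (det≡listDet X I id))
      (∩ℤ-respects isSubspace (sym ∘ cramer X rs j)
        (∩ℤ-expand isSubspace (λ a _ → X a j) (λ zs r → minor X (r ∷ zs)) rs
          λ a zs 1+∣zs∣≡∣rs∣ → ∩ℤ-* isSubspace (X a j)
            -- Deleting one of the J + 1 rows leaves a list of length J, as `minors∈S` requires.
            (minors∈S zs (ℕ.suc-injective (trans 1+∣zs∣≡∣rs∣ (length-tabulate I))))))
    where
    rs : List (Fin N)
    rs = tabulate I

-- Heights

height≤ : ∀ {N h} (x : Vector ℤ N) → (∀ i → ℤ.∣ x i ∣ ℕ.≤ h) → height x ℕ.≤ h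
height≤ {zero}  x x≤h = z≤n
height≤ {suc N} x x≤h = ℕ.⊔-lub (x≤h zero) (height≤ (x ∘ suc) (x≤h ∘ suc))

fromℕ-mono-≤ : ∀ {m n} → m ℕ.≤ n → fromℕ m ≤ fromℕ n
fromℕ-mono-≤ m≤n = ℚ.*≤* (ℤ.*-monoʳ-≤-nonNeg 1ℤ (ℤ.+≤+ m≤n))

open RawSemiringDefinitions ℚ.+-*-rawSemiring using () renaming (_^_ to _^ℚ_)

^-nonNeg : ∀ p .{{_ : ℚ.NonNegative p}} n → ℚ.NonNegative (p ^ℚ n)
^-nonNeg p zero    = _
^-nonNeg p (suc n) = ℚ.nonNeg*nonNeg⇒nonNeg p (p ^ℚ n) {{^-nonNeg p n}}

-- The summand `fromℕ (suc J)` is already at least 1, and the other summand is nonnegative.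
1≤constant : ∀ J → 1ℚ ≤ constant (suc J)
1≤constant J = begin
  1ℚ                                  ≤⟨ fromℕ-mono-≤ {1} {suc J} (ℕ.s≤s z≤n) ⟩
  fromℕ (suc J)                       ≡⟨ ℚ.+-identityˡ (fromℕ (suc J)) ⟨
  ℚ.0ℚ ℚ.+ fromℕ (suc J)              ≤⟨ ℚ.+-monoˡ-≤ (fromℕ (suc J)) (ℚ.nonNegative⁻¹ (fromℕ k * q)
                                           {{ℚ.nonNeg*nonNeg⇒nonNeg (fromℕ k) q {{^-nonNeg (+ 3 ℚ./ 2) J}}}}) ⟩
  constant (suc J)                    ∎
  where
  open ℚ.≤-Reasoning
  k : ℕ
  k = 2 ℕ.* suc J ℕ.^ suc J
  q : ℚ
  q = (+ 3 ℚ./ 2) ^ℚ J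

fromℕ≤constant*fromℕ : ∀ J {m n} → m ℕ.≤ n → fromℕ m ≤ constant (suc J) * fromℕ n
fromℕ≤constant*fromℕ J {m} {n} m≤n = begin
  fromℕ m                      ≤⟨ fromℕ-mono-≤ m≤n ⟩
  fromℕ n                      ≡⟨ ℚ.*-identityˡ (fromℕ n) ⟨
  1ℚ * fromℕ n                 ≤⟨ ℚ.*-monoʳ-≤-nonNeg (fromℕ n) (1≤constant J) ⟩
  constant (suc J) * fromℕ n   ∎
  where open ℚ.≤-Reasoning

corollary5p2 :
    ∀ {ℓ} → ExcludedMiddle ℓ →
    ∀ (d₁ d₂ : ℕ) (ρ : Vector ℝ d₁ → Vector ℝ d₂) → IsLinear d₁ d₂ ρ →
    (∀ (x : Vector ℤ d₁) → ∃ λ (y : Vector ℤ d₂) → ∀ i → ρ (ι x) i ≈ ι y i) →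
    let U = Ker ρ
        Ω = U ∩ℤ
    in
    ∀ (J : ℕ) (X : Matrix d₁ J) → IsBasis Ω X →
    ∀ (U₀ : Pred (Vector ℝ d₁) ℓ) → IsSubspace d₁ U₀ → U₀ ⊆ U →
    Ω ⊈ (U₀ ∩ℤ) →
    ∃ λ (x : Vector ℤ d₁) → x ∈ Ω × x ∉ (U₀ ∩ℤ) ×
      fromℕ (height x) ≤ constant J * fromℕ (latticeHeight X)
corollary5p2 em d₁ d₂ ρ linear _ zero X basis U₀ subspace _ Ω⊈U₀ =
  -- With an empty basis Ω contains only 0, which lies in every subspace.
  ⊥-elim $ Ω⊈U₀ λ {x} x∈Ω →
    let c , Xc≗x = IsBasis.generating basis x x∈Ω
    in ∩ℤ-respects subspace Xc≗x (∩ℤ-0 subspace)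
corollary5p2 em d₁ d₂ ρ linear _ (suc J) X basis U₀ subspace _ Ω⊈U₀
  -- Membership in `U₀` is an arbitrary predicate, so the search for a vector of minors outside it
  -- is decided classically.
  with em {∃ λ rs → length rs ≡ J × (λ r → minor X (r ∷ rs)) ∉ (U₀ ∩ℤ)}
... | yes (rs , ∣rs∣≡J , x∉U₀) =
  x , minors∈ (ker-isSubspace linear) X (IsBasis.columns-in basis) rs , x∉U₀ ,
  -- Each entry is a minor on J + 1 listed rows, so the lattice height bounds it even when `r`
  -- occurs in `rs`.
  fromℕ≤constant*fromℕ J (height≤ x λ r → ∣minor∣≤latticeHeight X (r ∷ rs) (cong suc ∣rs∣≡J))
  where
  x : Vector ℤ d₁
  x r = minor X (r ∷ rs)
-- Now `U₀` contains every vector of minors, hence every basis column, hence all of Ω.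
... | no all∈U₀ = ⊥-elim $ Ω⊈U₀ λ {x} x∈Ω →
  let c , Xc≗x = IsBasis.generating basis x x∈Ω
  in ∩ℤ-respects subspace Xc≗x (∩ℤ-· subspace X c
       (columns∈ subspace X (IsBasis.independent basis)
         λ rs ∣rs∣≡J → decidable-stable em λ x∉U₀ → all∈U₀ (rs , ∣rs∣≡J , x∉U₀)))
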